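{- Let $1<k\le v$ be integers and let $C_{v,k}$ be the complete design. (a) $C_{v,k}$ is a $\mathrm{Sym}(v)$-pairwise transitive $2$-design if and only if $k=2$, $k=v-1$, or $k=v$. (b) $C_{v,k}$ is non-trivial and $G$-pairwise transitive if and only if $k=v-1\ge3$ and $G$ is a $2$-transitive subgroup of $\mathrm{Aut}(C_{v,k})=\mathrm{Sym}(v)$. Moreover $C_{v,v-1}$ is a symmetric $2$-design.
   Context: A design $\mathcal D=(\mathcal P,\mathcal B,\mathcal I)$ consists of finite sets $\mathcal P$ (points), $\mathcal B$ (blocks) and an incidence relation $\mathcal I\subseteq\mathcal P\times\mathcal B$. It is a $2$-$(v,k,\lambda)$ design (or $2$-design) if $|\mathcal P|=v$, each block is incident with exactly $k$ points, and each pair of distinct points is incident with exactly $\lambda$ common blocks. It is non-trivial if $2<k<v$, and symmetric if $|\mathcal B|=v$. The complete design $C_{v,k}$ ($1<k\le v$) has $v$ points and, for each $k$-subset $S$ of points, exactly one block whose set of incident points is $S$. An automorphism is a permutation of $\mathcal P\cup\mathcal B$ leaving $\mathcal P$ and $\mathcal B$ invariant setwise and preserving incidence; $\mathrm{Aut}(\mathcal D)$ is the group of all automorphisms, and $\mathrm{Aut}(C_{v,k})$ is identified with $\mathrm{Sym}(v)$ via its action on points. Two blocks are intersecting if some point is incident with both. For $G\le\mathrm{Aut}(\mathcal D)$, the $2$-design $\mathcal D$ is $G$-pairwise transitive if $G$ is transitive on each of the following five (possibly empty) sets of ordered pairs: pairs of distinct points, incident point-block pairs, non-incident point-block pairs,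 pairs of distinct intersecting blocks, pairs of non-intersecting blocks. -}

module Defs where

open import Algebra.Bundles using (Group)
open import Data.Fin using (Fin)
open import Data.Fin.Properties using (+↔⊎)
open import Data.Fin.Subset using (Subset; inside; outside; ∣_∣; _∈_)
open import Data.Fin.Subset.Properties using (_∈?_)
open import Data.Nat using (ℕ; zero; suc; _+_; _<_)
open import Data.Nat.Properties using (≡-irrelevant; suc-injective)
open import Data.Product using (Σ; ∃; ∃-syntax; _×_; _,_; proj₁; proj₂)
open import Data.Product.Properties using (Σ-≡,≡→≡)
open import Data.Sum using (_⊎_; inj₁; inj₂)
open import Data.Sum.Function.Propositional using (_⊎-↔_)
open import Data.Unit.Polymorphic using (⊤; tt)
open import Data.Vec using ([]; _∷_)
open import Data.Vec.Properties.WithK using ([]=-irrelevant)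
open import Function.Bundles using (_↔_; _⇔_; Inverse; mk↔ₛ′)
open import Function.Construct.Composition using (_↔-∘_; _⇔-∘_)
open import Function.Construct.Identity using (↔-id; ⇔-id)
open import Function.Construct.Symmetry using (↔-sym; ⇔-sym)
open import Level using (Level; 0ℓ; _⊔_) renaming (suc to lsuc)
open import Relation.Binary.Core using (REL)
open import Relation.Binary.Definitions using (Decidable; Irrelevant)
open import Relation.Binary.PropositionalEquality
  using (_≡_; _≢_; refl; sym; trans; cong; subst; subst₂)
open import Relation.Nullary using (¬_)

open Inverse using (to; from; strictlyInverseˡ; strictlyInverseʳ)

private
  variable
    c ℓ s : Level

------------------------------------------------------------------------
-- Groups

record Subgroup (G : Group c ℓ) (s : Level) : Set (c ⊔ ℓ ⊔ lsuc s) where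
  open Group G
  field
    Member : Carrier → Set s
    resp   : ∀ {x y} → x ≈ y → Member x → Member y
    ε∈     : Member ε
    ∙∈     : ∀ {x y} → Member x → Member y → Member (x ∙ y)
    ⁻¹∈    : ∀ {x} → Member x → Member (x ⁻¹)

open Subgroup using (Member)

whole : (G : Group c ℓ) → Subgroup G 0ℓ
whole G = record
  { Member = λ _ → ⊤
  ; resp   = λ _ _ → tt
  ; ε∈     = tt
  ; ∙∈     = λ _ _ → tt
  ; ⁻¹∈    = λ _ → tt
  }

private
  module _ {X : Set} where

    _≗ₚ_ : (π ρ : X ↔ X) → Set
    π ≗ₚ ρ = ∀ x → to π x ≡ to ρ x

    from-cong : ∀ {π ρ : X ↔ X} → π ≗ₚ ρ → ∀ x → from π x ≡ from ρ x
    from-cong {π} {ρ} eq x =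
      trans (cong (from π) (sym (trans (eq (from ρ x)) (strictlyInverseˡ ρ x))))
            (strictlyInverseʳ π (from ρ x))

-- Products act right factor first: (π ∙ ρ)(x) = π(ρ(x)).
Sym : Set → Group 0ℓ 0ℓ
Sym X = record
  { Carrier = X ↔ X
  ; _≈_     = _≗ₚ_
  ; _∙_     = _↔-∘_
  ; ε       = ↔-id X
  ; _⁻¹     = ↔-sym
  ; isGroup = record
    { isMonoid = record
      { isSemigroup = record
        { isMagma = record
          { isEquivalence = record
            { refl  = λ _ → refl
            ; sym   = λ e x → sym (e x)
            ; trans = λ e f x → trans (e x) (f x)
            }
          ; ∙-cong = λ {π} {π′} {ρ} {ρ′} e f x → trans (cong (to π) (f x)) (e (to ρ′ x))
          }
        ; assoc = λ _ _ _ _ → refl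
        }
      ; identity = (λ _ _ → refl) , (λ _ _ → refl)
      }
    ; inverse = strictlyInverseʳ , strictlyInverseˡ
    ; ⁻¹-cong = λ {π} {ρ} → from-cong {π = π} {ρ}
    }
  }

TwoTransitive : ∀ {X : Set} → Subgroup (Sym X) s → Set s
TwoTransitive H = ∀ {x y x′ y′} → x ≢ y → x′ ≢ y′ →
  ∃[ π ] Member H π × to π x ≡ x′ × to π y ≡ y′

------------------------------------------------------------------------
-- Designs

HasSize : Set → ℕ → Set
HasSize A n = A ↔ Fin n

-- Incidence is proof-irrelevant, so that the Σ-types below really count
-- incident points and blocks.  Distinct blocks may have the same points.
record Design : Set₁ where
  infix 4 _I_
  field
    Point         : Set
    Block         : Set
    _I_           : REL Point Block 0ℓ
    I?            : Decidable _I_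
    I-irrelevant  : Irrelevant _I_
    finitePoints  : ∃[ n ] HasSize Point n
    finiteBlocks  : ∃[ n ] HasSize Block n

record Is2-⟨_,_,_⟩-Design (v k lam : ℕ) (D : Design) : Set where
  open Design D
  field
    points       : HasSize Point v
    blockSize    : ∀ b → HasSize (Σ Point λ p → p I b) k
    commonBlocks : ∀ {p q} → p ≢ q → HasSize (Σ Block λ b → p I b × q I b) lam

Is2Design : Design → Set
Is2Design D = ∃[ v ] ∃[ k ] ∃[ lam ] Is2-⟨ v , k , lam ⟩-Design D

IsNonTrivial2Design : Design → Set
IsNonTrivial2Design D = ∃[ v ] ∃[ k ] ∃[ lam ]
  Is2-⟨ v , k , lam ⟩-Design D × 2 < k × k < v

IsSymmetric2Design : Design → Set
IsSymmetric2Design D = ∃[ v ] ∃[ k ] ∃[ lam ]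
  Is2-⟨ v , k , lam ⟩-Design D × HasSize (Design.Block D) v

-- A permutation of the disjoint union of points and blocks leaving both
-- parts invariant is given by its restrictions to the two parts.
record Automorphism (D : Design) : Set where
  open Design D
  field
    onPoints  : Point ↔ Point
    onBlocks  : Block ↔ Block
    incidence : ∀ p b → p I b ⇔ to onPoints p I to onBlocks b

open Automorphism public using (onPoints; onBlocks)

Aut : Design → Group 0ℓ 0ℓ
Aut D = record
  { Carrier = Automorphism D
  ; _≈_     = λ α β → (onPoints α P.≈ onPoints β) × (onBlocks α B.≈ onBlocks β)
  ; _∙_     = λ α β → record
    { onPoints  = onPoints α ↔-∘ onPoints β
    ; onBlocks  = onBlocks α ↔-∘ onBlocks β
    ; incidence = λ p b → incidence α _ _ ⇔-∘ incidence β p b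
    }
  ; ε       = record
    { onPoints = ↔-id _ ; onBlocks = ↔-id _ ; incidence = λ p b → ⇔-id _ }
  ; _⁻¹     = λ α → record
    { onPoints  = ↔-sym (onPoints α)
    ; onBlocks  = ↔-sym (onBlocks α)
    ; incidence = λ p b → ⇔-sym
        (subst₂ (λ q c → from (onPoints α) p I from (onBlocks α) b ⇔ q I c)
          (strictlyInverseˡ (onPoints α) p) (strictlyInverseˡ (onBlocks α) b)
          (incidence α (from (onPoints α) p) (from (onBlocks α) b)))
    }
  ; isGroup = record
    { isMonoid = record
      { isSemigroup = record
        { isMagma = record
          { isEquivalence = record
            { refl  = (λ _ → refl) , (λ _ → refl)
            ; sym   = λ (e , f) → (λ x → sym (e x)) , (λ x → sym (f x))
            ; trans = λ (e , f) (e′ , f′) →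
                (λ x → trans (e x) (e′ x)) , (λ x → trans (f x) (f′ x))
            }
          ; ∙-cong = λ {α} {α′} {β} {β′} (e , f) (e′ , f′) →
              P.∙-cong {onPoints α} {onPoints α′} {onPoints β} {onPoints β′} e e′ ,
              B.∙-cong {onBlocks α} {onBlocks α′} {onBlocks β} {onBlocks β′} f f′
          }
        ; assoc = λ _ _ _ → (λ _ → refl) , (λ _ → refl)
        }
      ; identity = (λ _ → (λ _ → refl) , (λ _ → refl)) , (λ _ → (λ _ → refl) , (λ _ → refl))
      }
    ; inverse = (λ α → P.inverseˡ (onPoints α) , B.inverseˡ (onBlocks α))
              , (λ α → P.inverseʳ (onPoints α) , B.inverseʳ (onBlocks α))
    ; ⁻¹-cong = λ {α} {β} (e , f) →
        P.⁻¹-cong {onPoints α} {onPoints β} e , B.⁻¹-cong {onBlocks α} {onBlocks β} f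
    }
  }
  where
  open Design D
  open Automorphism using (incidence)
  module P = Group (Sym Point)
  module B = Group (Sym Block)

inducedOnPoints : ∀ {D} → Subgroup (Aut D) s → Subgroup (Sym (Design.Point D)) s
inducedOnPoints {D = D} G = record
  { Member = λ π → ∃[ α ] Member G α × onPoints α P.≈ π
  ; resp   = λ {π} {ρ} e (α , g , f) → α , g , (λ x → trans (f x) (e x))
  ; ε∈     = A.ε , ε∈ , (λ _ → refl)
  ; ∙∈     = λ {π} {ρ} (α , g , e) (β , h , f) →
      α A.∙ β , ∙∈ g h , P.∙-cong {onPoints α} {π} {onPoints β} {ρ} e f
  ; ⁻¹∈    = λ {π} (α , g , e) → α A.⁻¹ , ⁻¹∈ g , P.⁻¹-cong {onPoints α} {π} e
  }
  where
  open Subgroup G using (ε∈; ∙∈; ⁻¹∈)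
  module A = Group (Aut D)
  module P = Group (Sym (Design.Point D))

------------------------------------------------------------------------
-- Pairwise transitivity

module _ {D : Design} where
  open Design D

  Intersecting : Block → Block → Set
  Intersecting b c = ∃[ p ] p I b × p I c

  -- Transitivity on the set of ordered pairs satisfying R, where an
  -- automorphism α acts by (x , y) ↦ (α x , α y).
  TransitiveOnPairs : Subgroup (Aut D) s → {X Y : Set} →
    (Automorphism D → X ↔ X) → (Automorphism D → Y ↔ Y) → REL X Y 0ℓ → Set s
  TransitiveOnPairs G {X} {Y} f g R = ∀ {x x′ : X} {y y′ : Y} → R x y → R x′ y′ →
    ∃[ α ] Member G α × to (f α) x ≡ x′ × to (g α) y ≡ y′

  record PairwiseTransitive (G : Subgroup (Aut D) s) : Set s where
    field
      points          : TransitiveOnPairs G onPoints onPoints _≢_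
      flags           : TransitiveOnPairs G onPoints onBlocks _I_
      antiflags       : TransitiveOnPairs G onPoints onBlocks (λ p b → ¬ p I b)
      intersecting    : TransitiveOnPairs G onBlocks onBlocks
                          (λ b c → b ≢ c × Intersecting b c)
      nonIntersecting : TransitiveOnPairs G onBlocks onBlocks
                          (λ b c → ¬ Intersecting b c)

------------------------------------------------------------------------
-- Complete designs

KSubset : ℕ → ℕ → Set
KSubset v k = Σ (Subset v) λ S → ∣ S ∣ ≡ k

KSubset-≡ : ∀ {v k} {S T : KSubset v k} → proj₁ S ≡ proj₁ T → S ≡ T
KSubset-≡ e = Σ-≡,≡→≡ (e , ≡-irrelevant _ _)

KSubset-outside : ∀ {v} → KSubset (suc v) 0 ↔ KSubset v 0
KSubset-outside {v} = mk↔ₛ′ f g (λ _ → refl) g∘f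
  where
  f : KSubset (suc v) 0 → KSubset v 0
  f (inside  ∷ S , ())
  f (outside ∷ S , q) = S , q

  g : KSubset v 0 → KSubset (suc v) 0
  g (S , q) = outside ∷ S , q

  g∘f : ∀ S → g (f S) ≡ S
  g∘f (inside  ∷ S , ())
  g∘f (outside ∷ S , q) = refl

KSubset-split : ∀ {v k} → KSubset (suc v) (suc k) ↔ (KSubset v k ⊎ KSubset v (suc k))
KSubset-split {v} {k} = mk↔ₛ′ f g f∘g g∘f
  where
  f : KSubset (suc v) (suc k) → KSubset v k ⊎ KSubset v (suc k)
  f (inside  ∷ S , q) = inj₁ (S , suc-injective q)
  f (outside ∷ S , q) = inj₂ (S , q)

  g : KSubset v k ⊎ KSubset v (suc k) → KSubset (suc v) (suc k)
  g (inj₁ (S , q)) = inside ∷ S , cong suc q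
  g (inj₂ (S , q)) = outside ∷ S , q

  f∘g : ∀ S → f (g S) ≡ S
  f∘g (inj₁ _) = cong inj₁ (KSubset-≡ refl)
  f∘g (inj₂ _) = refl

  g∘f : ∀ S → g (f S) ≡ S
  g∘f (inside  ∷ S , q) = KSubset-≡ refl
  g∘f (outside ∷ S , q) = refl

KSubset-finite : ∀ v k → ∃[ n ] HasSize (KSubset v k) n
KSubset-finite zero zero = 1 , mk↔ₛ′ (λ _ → Fin.zero) (λ _ → [] , refl)
  (λ { Fin.zero → refl ; (Fin.suc ()) }) (λ { ([] , refl) → refl })
KSubset-finite zero (suc k) = 0 , mk↔ₛ′ (λ { ([] , ()) }) (λ ()) (λ ()) (λ { ([] , ()) })
KSubset-finite (suc v) zero =
  let n , e = KSubset-finite v zero in n , e ↔-∘ KSubset-outside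
KSubset-finite (suc v) (suc k) =
  let m , e = KSubset-finite v k
      n , f = KSubset-finite v (suc k)
  in m + n , ↔-sym +↔⊎ ↔-∘ ((e ⊎-↔ f) ↔-∘ KSubset-split)

completeDesign : ℕ → ℕ → Design
completeDesign v k = record
  { Point        = Fin v
  ; Block        = KSubset v k
  ; _I_          = λ p b → p ∈ proj₁ b
  ; I?           = λ p b → p ∈? proj₁ b
  ; I-irrelevant = []=-irrelevant
  ; finitePoints = v , ↔-id _
  ; finiteBlocks = KSubset-finite v k
  }

{-# OPTIONS --safe #-}
module Submission where

-- A permutation carries one pair of subsets of a v-set to another as soon as
-- the sizes of the subsets and of their intersections agree, because then the
-- four cells of the two partitions have the same sizes.  Treating points as singletons,
-- this settles transitivity of Sym(v) on every pair except that of distinct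
-- intersecting blocks, where |b ∩ c| has to be constant: it is 1 for k = 2,
-- there are no such pairs for k = v, and for 2 < k < v − 1 both k − 1 and k − 2
-- occur.  For k = v − 1 the blocks are the complements of points, so every
-- orbit statement becomes one about pairs of points.

open import Defs
open import Algebra.Bundles using (Group)
open import Algebra.Morphism.Structures using (IsGroupIsomorphism)
open import Data.Bool using (not)
open import Data.Bool.Properties using (not-involutive; not-injective)
open import Data.Fin using (Fin; zero; suc; punchIn; punchOut)
open import Data.Fin.Permutation using (↔⇒≡; cast-id)
open import Data.Fin.Properties using (_≟_; punchInᵢ≢i; punchIn-punchOut; punchIn-injective)
open import Data.Fin.Subset
  using (Subset; Side; inside; outside; ∣_∣; _∈_; _⊆_; _∩_; ∁; ⁅_⁆; Empty; Nonempty; ⊥)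
open import Data.Fin.Subset.Properties
  using (∣⊥∣≡0; ∣p∣≡n⇒p≡⊤; x∈⁅x⁆; x∈⁅y⁆⇒x≡y; ∣⁅x⁆∣≡1; ⊆-antisym; p⊆q⇒∣p∣≤∣q∣;
         x∉p⇒x∈∁p; x∈∁p⇒x∉p; ∣∁p∣≡n∸∣p∣; p∩q⊆p; x∈p∩q⁺; x∈p∩q⁻; ∩-comm;
         ∣p∩q∣≤∣p∣; Empty-unique; x∉⁅y⁆⇒x≢y; x≢y⇒x∉⁅y⁆)
open import Data.Nat using (ℕ; zero; suc; _+_; _∸_; _≤_; _<_; _≥_; z≤n; s≤s; s≤s⁻¹)
open import Data.Nat.Properties
  using (≤-reflexive; ≤-trans; <⇒≢; n<1+n; 1+n≰n; +-suc; +-cancelˡ-≡;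
         suc-injective; m∸n≤m; ≤∧≢⇒<; m+n∸n≡m)
  renaming (_≟_ to _≟ℕ_)
open import Data.Product using (Σ; ∃-syntax; _×_; _,_; proj₁; proj₂)
open import Data.Product.Properties using (Σ-≡,≡→≡; ,-injectiveˡ; ,-injectiveʳ)
open import Data.Sum using (_⊎_; inj₁; inj₂)
open import Data.Vec using ([]; _∷_; here; there; lookup; tabulate)
open import Data.Vec.Properties
  using ([]=⇒lookup; lookup⇒[]=; lookup∘tabulate; lookup-map; map-∘; map-cong; map-id)
open import Data.Vec.Properties.WithK using ([]=-irrelevant)
open import Data.Unit.Polymorphic using (tt)
open import Function.Base using (_∘_)
open import Function.Bundles using (_↔_; _⇔_; Inverse; Equivalence; mk↔ₛ′; mk⇔)
open import Function.Construct.Composition using (_↔-∘_; _⇔-∘_)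
open import Function.Construct.Identity using (↔-id)
open import Function.Construct.Symmetry using (↔-sym; ⇔-sym)
open import Level using (Level)
open import Relation.Binary.PropositionalEquality
  using (_≡_; _≢_; refl; sym; trans; cong; cong₂; subst; subst₂; module ≡-Reasoning)
open import Relation.Binary.PropositionalEquality.WithK using (≡-irrelevant)
open import Relation.Nullary using (¬_; yes; no; contradiction)
open import Relation.Unary using (Irrelevant)

open Inverse using (to; from; strictlyInverseˡ; strictlyInverseʳ)
open Equivalence using () renaming (to to ⇒; from to ⇐)

private
  variable
    s : Level
    k v : ℕ
    X Y Z : Set

Σ-↔-irrelevant : {P : X → Set} {Q : Y → Set} (π : X ↔ Y) →
  Irrelevant P → Irrelevant Q → (∀ x → P x ⇔ Q (to π x)) → Σ X P ↔ Σ Y Q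
Σ-↔-irrelevant {Q = Q} π irrP irrQ P⇔Q = mk↔ₛ′
  (λ (x , p) → to π x , ⇒ (P⇔Q x) p)
  (λ (y , q) → from π y ,
    ⇐ (P⇔Q (from π y)) (subst Q (sym (strictlyInverseˡ π y)) q))
  (λ (y , _) → Σ-≡,≡→≡ (strictlyInverseˡ π y , irrQ _ _))
  (λ (x , _) → Σ-≡,≡→≡ (strictlyInverseʳ π x , irrP _ _))

glueFibres : (f : X → Z) (g : Y → Z) →
  (∀ c → (Σ X λ x → f x ≡ c) ↔ (Σ Y λ y → g y ≡ c)) →
  Σ (X ↔ Y) λ π → ∀ x → g (to π x) ≡ f x
glueFibres {X = X} {Y = Y} f g φ = mk↔ₛ′ fwd bwd fwd-bwd bwd-fwd ,
  λ x → proj₂ (to (φ (f x)) (x , refl))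
  where
  fwd : X → Y
  fwd x = proj₁ (to (φ (f x)) (x , refl))

  bwd : Y → X
  bwd y = proj₁ (from (φ (g y)) (y , refl))

  fwd-fibre : ∀ {c} (z : Σ X λ x → f x ≡ c) → fwd (proj₁ z) ≡ proj₁ (to (φ c) z)
  fwd-fibre (x , refl) = refl

  bwd-fibre : ∀ {c} (z : Σ Y λ y → g y ≡ c) → bwd (proj₁ z) ≡ proj₁ (from (φ c) z)
  bwd-fibre (y , refl) = refl

  fwd-bwd : ∀ y → fwd (bwd y) ≡ y
  fwd-bwd y = trans (fwd-fibre (from (φ (g y)) (y , refl)))
                    (cong proj₁ (strictlyInverseˡ (φ (g y)) (y , refl)))

  bwd-fwd : ∀ x → bwd (fwd x) ≡ x
  bwd-fwd x = trans (bwd-fibre (to (φ (f x)) (x , refl)))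
                    (cong proj₁ (strictlyInverseʳ (φ (f x)) (x , refl)))

-- Subsets of a finite set

elements : (S : Subset v) → Σ (Fin v) (_∈ S) ↔ Fin ∣ S ∣
elements []            = mk↔ₛ′ (λ ()) (λ ()) (λ ()) (λ ())
elements (outside ∷ S) = elements S ↔-∘ mk↔ₛ′
  (λ { (suc x , there x∈S) → x , x∈S }) (λ (x , x∈S) → suc x , there x∈S)
  (λ _ → refl) (λ { (suc x , there x∈S) → refl })
elements {suc v} (inside ∷ S) = mk↔ₛ′ fwd bwd fwd-bwd bwd-fwd
  where
  fwd : Σ (Fin (suc v)) (_∈ inside ∷ S) → Fin (suc ∣ S ∣)
  fwd (zero  , here)      = zero
  fwd (suc x , there x∈S) = suc (to (elements S) (x , x∈S))

  bwd : Fin (suc ∣ S ∣) → Σ (Fin (suc v)) (_∈ inside ∷ S)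
  bwd zero    = zero , here
  bwd (suc i) = let x , x∈S = from (elements S) i in suc x , there x∈S

  fwd-bwd : ∀ i → fwd (bwd i) ≡ i
  fwd-bwd zero    = refl
  fwd-bwd (suc i) = cong suc (strictlyInverseˡ (elements S) i)

  bwd-fwd : ∀ z → bwd (fwd z) ≡ z
  bwd-fwd (zero  , here)      = refl
  bwd-fwd (suc x , there x∈S) =
    cong (λ (y , y∈S) → suc y , there y∈S) (strictlyInverseʳ (elements S) (x , x∈S))

subset-ext : {S T : Subset v} → (∀ x → x ∈ S ⇔ x ∈ T) → S ≡ T
subset-ext S⇔T = ⊆-antisym (λ {x} → ⇒ (S⇔T x)) (λ {x} → ⇐ (S⇔T x))

subsetOfSize : ∀ {m n} → m ≤ n → Σ (Subset n) λ S → ∣ S ∣ ≡ m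
subsetOfSize {n = n} z≤n = ⊥ , ∣⊥∣≡0 n
subsetOfSize (s≤s m≤n)   = let S , e = subsetOfSize m≤n in inside ∷ S , cong suc e

∁-involutive : (S : Subset v) → ∁ (∁ S) ≡ S
∁-involutive S = trans (sym (map-∘ _ _ S)) (trans (map-cong not-involutive S) (map-id S))

∣p∣≡0⇒p≡⊥ : (S : Subset v) → ∣ S ∣ ≡ 0 → S ≡ ⊥
∣p∣≡0⇒p≡⊥ []            _ = refl
∣p∣≡0⇒p≡⊥ (outside ∷ S) e = cong (outside ∷_) (∣p∣≡0⇒p≡⊥ S e)

∣p∣≡1⇒singleton : (S : Subset v) → ∣ S ∣ ≡ 1 → ∃[ x ] S ≡ ⁅ x ⁆
∣p∣≡1⇒singleton (inside ∷ S)  e = zero , cong (inside ∷_) (∣p∣≡0⇒p≡⊥ S (suc-injective e))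
∣p∣≡1⇒singleton (outside ∷ S) e =
  let x , S≡ = ∣p∣≡1⇒singleton S e in suc x , cong (outside ∷_) S≡

⁅x⁆-injective : {x y : Fin v} → ⁅ x ⁆ ≡ ⁅ y ⁆ → x ≡ y
⁅x⁆-injective {x = x} {y} e = x∈⁅y⁆⇒x≡y y (subst (x ∈_) e (x∈⁅x⁆ x))

⁅x⁆⊆p : {x : Fin v} {S : Subset v} → x ∈ S → ⁅ x ⁆ ⊆ S
⁅x⁆⊆p {x = x} {S} x∈S y∈ = subst (_∈ S) (sym (x∈⁅y⁆⇒x≡y x y∈)) x∈S

nonempty⇒0<∣p∣ : {S : Subset v} → Nonempty S → 0 < ∣ S ∣
nonempty⇒0<∣p∣ (x , x∈S) =
  ≤-trans (≤-reflexive (sym (∣⁅x⁆∣≡1 x))) (p⊆q⇒∣p∣≤∣q∣ (⁅x⁆⊆p x∈S))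

empty⇒∣p∣≡0 : {S : Subset v} → Empty S → ∣ S ∣ ≡ 0
empty⇒∣p∣≡0 {v} e = trans (cong ∣_∣ (Empty-unique e)) (∣⊥∣≡0 v)

∣p∣≤∣p∩q∣⇒p⊆q : (p q : Subset v) → ∣ p ∣ ≤ ∣ p ∩ q ∣ → p ⊆ q
∣p∣≤∣p∩q∣⇒p⊆q (inside  ∷ p) (inside  ∷ q) le here        = here
∣p∣≤∣p∩q∣⇒p⊆q (inside  ∷ p) (inside  ∷ q) le (there x∈p) =
  there (∣p∣≤∣p∩q∣⇒p⊆q p q (s≤s⁻¹ le) x∈p)
∣p∣≤∣p∩q∣⇒p⊆q (inside  ∷ p) (outside ∷ q) le _           =
  contradiction (≤-trans le (∣p∩q∣≤∣p∣ p q)) 1+n≰n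
∣p∣≤∣p∩q∣⇒p⊆q (outside ∷ p) (_       ∷ q) le (there x∈p) =
  there (∣p∣≤∣p∩q∣⇒p⊆q p q le x∈p)

∣p∩q∣+∣p∩∁q∣≡∣p∣ : (p q : Subset v) → ∣ p ∩ q ∣ + ∣ p ∩ ∁ q ∣ ≡ ∣ p ∣
∣p∩q∣+∣p∩∁q∣≡∣p∣ []            []            = refl
∣p∩q∣+∣p∩∁q∣≡∣p∣ (outside ∷ p) (_       ∷ q) = ∣p∩q∣+∣p∩∁q∣≡∣p∣ p q
∣p∩q∣+∣p∩∁q∣≡∣p∣ (inside  ∷ p) (inside  ∷ q) = cong suc (∣p∩q∣+∣p∩∁q∣≡∣p∣ p q)
∣p∩q∣+∣p∩∁q∣≡∣p∣ (inside  ∷ p) (outside ∷ q) =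
  trans (+-suc _ _) (cong suc (∣p∩q∣+∣p∩∁q∣≡∣p∣ p q))

∣∩∁∣-cong : (p p′ q q′ : Subset v) → ∣ p ∣ ≡ ∣ p′ ∣ → ∣ p ∩ q ∣ ≡ ∣ p′ ∩ q′ ∣ →
  ∣ p ∩ ∁ q ∣ ≡ ∣ p′ ∩ ∁ q′ ∣
∣∩∁∣-cong p p′ q q′ e f = +-cancelˡ-≡ ∣ p ∩ q ∣ _ _ (begin
  ∣ p ∩ q ∣ + ∣ p ∩ ∁ q ∣      ≡⟨ ∣p∩q∣+∣p∩∁q∣≡∣p∣ p q ⟩
  ∣ p ∣                        ≡⟨ e ⟩
  ∣ p′ ∣                       ≡⟨ ∣p∩q∣+∣p∩∁q∣≡∣p∣ p′ q′ ⟨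
  ∣ p′ ∩ q′ ∣ + ∣ p′ ∩ ∁ q′ ∣  ≡⟨ cong (_+ ∣ p′ ∩ ∁ q′ ∣) f ⟨
  ∣ p ∩ q ∣ + ∣ p′ ∩ ∁ q′ ∣    ∎)
  where open ≡-Reasoning

∣∁∣-cong : (p q : Subset v) → ∣ p ∣ ≡ ∣ q ∣ → ∣ ∁ p ∣ ≡ ∣ ∁ q ∣
∣∁∣-cong {v} p q e =
  trans (∣∁p∣≡n∸∣p∣ p) (trans (cong (v ∸_) e) (sym (∣∁p∣≡n∸∣p∣ q)))

-- Permutations carrying subsets to subsets

Carries : Fin v ↔ Fin v → Subset v → Subset v → Set
Carries π S T = ∀ x → x ∈ S ⇔ to π x ∈ T

carries-size : (π : Fin v ↔ Fin v) {S T : Subset v} → Carries π S T → ∣ S ∣ ≡ ∣ T ∣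
carries-size π {S} {T} c = ↔⇒≡
  (elements T ↔-∘ (Σ-↔-irrelevant π []=-irrelevant []=-irrelevant c ↔-∘ ↔-sym (elements S)))

carries-unique : (π : Fin v ↔ Fin v) {S T T′ : Subset v} →
  Carries π S T → Carries π S T′ → T ≡ T′
carries-unique π {T = T} {T′} c c′ = subset-ext λ y →
  subst (λ z → z ∈ T ⇔ z ∈ T′) (strictlyInverseˡ π y)
    (c′ (from π y) ⇔-∘ ⇔-sym (c (from π y)))

carries-∩ : (π : Fin v ↔ Fin v) {S T S′ T′ : Subset v} →
  Carries π S S′ → Carries π T T′ → Carries π (S ∩ T) (S′ ∩ T′)
carries-∩ π {S} {T} {S′} {T′} c d x = mk⇔
  (λ h → let a , b = x∈p∩q⁻ S T h in x∈p∩q⁺ (⇒ (c x) a , ⇒ (d x) b))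
  (λ h → let a , b = x∈p∩q⁻ S′ T′ h in x∈p∩q⁺ (⇐ (c x) a , ⇐ (d x) b))

carries-⁅⁆ : (π : Fin v ↔ Fin v) (x y : Fin v) → Carries π ⁅ x ⁆ ⁅ y ⁆ → to π x ≡ y
carries-⁅⁆ π x y c = x∈⁅y⁆⇒x≡y y (⇒ (c x) (x∈⁅x⁆ x))

image : Fin v ↔ Fin v → Subset v → Subset v
image π S = tabulate (lookup S ∘ from π)

∈⇔lookup : {S : Subset v} (x : Fin v) → x ∈ S ⇔ lookup S x ≡ inside
∈⇔lookup {S = S} x = mk⇔ []=⇒lookup (lookup⇒[]= x S)

carries-lookup : (π : Fin v ↔ Fin v) {S T : Subset v} →
  (∀ x → lookup T (to π x) ≡ lookup S x) → Carries π S T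
carries-lookup π e x = mk⇔
  (λ x∈S → lookup⇒[]= _ _ (trans (e x) ([]=⇒lookup x∈S)))
  (λ πx∈T → lookup⇒[]= _ _ (trans (sym (e x)) ([]=⇒lookup πx∈T)))

carries-image : (π : Fin v ↔ Fin v) (S : Subset v) → Carries π S (image π S)
carries-image π S = carries-lookup π λ x →
  trans (lookup∘tabulate (lookup S ∘ from π) (to π x)) (cong (lookup S) (strictlyInverseʳ π x))

side : Side → Subset v → Subset v
side inside  S = S
side outside S = ∁ S

∈-side : ∀ i (S : Subset v) (x : Fin v) → x ∈ side i S ⇔ lookup S x ≡ i
∈-side inside  S x = ∈⇔lookup x
∈-side outside S x = mk⇔
  (λ h → not-injective (trans (sym (lookup-map x not S)) ([]=⇒lookup h)))
  (λ e → lookup⇒[]= x _ (trans (lookup-map x not S) (cong not e)))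

∣side∩side∣-cong : (S T S′ T′ : Subset v) →
  ∣ S ∣ ≡ ∣ S′ ∣ → ∣ T ∣ ≡ ∣ T′ ∣ → ∣ S ∩ T ∣ ≡ ∣ S′ ∩ T′ ∣ →
  ∀ i j → ∣ side i S ∩ side j T ∣ ≡ ∣ side i S′ ∩ side j T′ ∣
∣side∩side∣-cong S T S′ T′ e f g inside inside = g
∣side∩side∣-cong S T S′ T′ e f g inside outside = ∣∩∁∣-cong S S′ T T′ e g
∣side∩side∣-cong S T S′ T′ e f g outside inside = begin
  ∣ ∁ S ∩ T ∣    ≡⟨ cong ∣_∣ (∩-comm (∁ S) T) ⟩
  ∣ T ∩ ∁ S ∣    ≡⟨ ∣∩∁∣-cong T T′ S S′ f
                      (subst₂ (λ p q → ∣ p ∣ ≡ ∣ q ∣) (∩-comm S T) (∩-comm S′ T′) g) ⟩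
  ∣ T′ ∩ ∁ S′ ∣  ≡⟨ cong ∣_∣ (∩-comm T′ (∁ S′)) ⟩
  ∣ ∁ S′ ∩ T′ ∣  ∎
  where open ≡-Reasoning
∣side∩side∣-cong S T S′ T′ e f g outside outside =
  ∣∩∁∣-cong (∁ S) (∁ S′) T T′ (∣∁∣-cong S S′ e)
    (∣side∩side∣-cong S T S′ T′ e f g outside inside)

carry-pair : (S T S′ T′ : Subset v) →
  ∣ S ∣ ≡ ∣ S′ ∣ → ∣ T ∣ ≡ ∣ T′ ∣ → ∣ S ∩ T ∣ ≡ ∣ S′ ∩ T′ ∣ →
  ∃[ π ] Carries π S S′ × Carries π T T′
carry-pair {v} S T S′ T′ e f g =
  π , carries-lookup π (,-injectiveˡ ∘ same) , carries-lookup π (,-injectiveʳ ∘ same)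
  where
  colour : Subset v → Subset v → Fin v → Side × Side
  colour P Q x = lookup P x , lookup Q x

  cell : ∀ P Q i j → (Σ (Fin v) λ x → colour P Q x ≡ (i , j)) ↔ Fin ∣ side i P ∩ side j Q ∣
  cell P Q i j = elements _ ↔-∘ Σ-↔-irrelevant (↔-id _) ≡-irrelevant []=-irrelevant λ x → mk⇔
    (λ c → x∈p∩q⁺ (⇐ (∈-side i P x) (,-injectiveˡ c) , ⇐ (∈-side j Q x) (,-injectiveʳ c)))
    (λ h → let a , b = x∈p∩q⁻ (side i P) (side j Q) h in
      cong₂ _,_ (⇒ (∈-side i P x) a) (⇒ (∈-side j Q x) b))

  glued : Σ (Fin v ↔ Fin v) λ π → ∀ x → colour S′ T′ (to π x) ≡ colour S T x
  glued = glueFibres (colour S T) (colour S′ T′) λ (i , j) → ↔-sym (cell S′ T′ i j) ↔-∘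
    (cast-id (∣side∩side∣-cong S T S′ T′ e f g i j) ↔-∘ cell S T i j)

  π    = proj₁ glued
  same = proj₂ glued

-- Automorphisms of complete designs

carries-onBlocks : (α : Automorphism (completeDesign v k)) (b : KSubset v k) →
  Carries (onPoints α) (proj₁ b) (proj₁ (to (onBlocks α) b))
carries-onBlocks α b x = Automorphism.incidence α x b

onBlocks-≡ : (α : Automorphism (completeDesign v k)) (b c : KSubset v k) →
  Carries (onPoints α) (proj₁ b) (proj₁ c) → to (onBlocks α) b ≡ c
onBlocks-≡ α b c h = KSubset-≡ (carries-unique (onPoints α) (carries-onBlocks α b) h)

carries-cong : (π ρ : Fin v ↔ Fin v) {S T : Subset v} →
  (∀ x → to π x ≡ to ρ x) → Carries π S T → Carries ρ S T
carries-cong π ρ {T = T} e c x = subst (λ y → _ ⇔ y ∈ T) (e x) (c x)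

carries-sym : (π : Fin v ↔ Fin v) {S T : Subset v} → Carries π S T → Carries (↔-sym π) T S
carries-sym π {T = T} c y =
  ⇔-sym (subst (λ z → _ ⇔ z ∈ T) (strictlyInverseˡ π y) (c (from π y)))

imageBlock : Fin v ↔ Fin v → KSubset v k → KSubset v k
imageBlock π (S , e) = image π S , trans (sym (carries-size π (carries-image π S))) e

liftAut : Fin v ↔ Fin v → Automorphism (completeDesign v k)
liftAut {v} {k} π = record
  { onPoints  = π
  ; onBlocks  = mk↔ₛ′ (imageBlock π) (imageBlock (↔-sym π)) (cancel (↔-sym π)) (cancel π)
  ; incidence = λ x b → carries-image π (proj₁ b) x
  }
  where
  cancel : (ρ : Fin v ↔ Fin v) (b : KSubset v k) → imageBlock (↔-sym ρ) (imageBlock ρ b) ≡ b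
  cancel ρ (S , _) = KSubset-≡ (carries-unique (↔-sym ρ)
    (carries-image (↔-sym ρ) (image ρ S)) (carries-sym ρ (carries-image ρ S)))

onPoints-isGroupIsomorphism : ∀ v k → IsGroupIsomorphism
  (Group.rawGroup (Aut (completeDesign v k))) (Group.rawGroup (Sym (Fin v))) onPoints
onPoints-isGroupIsomorphism v k = record
  { isGroupMonomorphism = record
    { isGroupHomomorphism = record
      { isMonoidHomomorphism = record
        { isMagmaHomomorphism = record
          { isRelHomomorphism = record { cong = proj₁ }
          ; homo              = λ _ _ _ → refl
          }
        ; ε-homo = λ _ → refl
        }
      ; ⁻¹-homo = λ _ _ → refl
      }
    ; injective = λ {α} {β} e → e , λ b → onBlocks-≡ α b (to (onBlocks β) b)
        (carries-cong (onPoints β) (onPoints α) (λ x → sym (e x)) (carries-onBlocks β b))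
    }
  ; surjective = λ π → liftAut π , proj₁
  }

-- Complete designs are 2-designs

∣⁅x⁆∩p∣≡1 : {x : Fin v} {S : Subset v} → x ∈ S → ∣ ⁅ x ⁆ ∩ S ∣ ≡ 1
∣⁅x⁆∩p∣≡1 {x = x} {S} x∈S = trans (cong ∣_∣ (⊆-antisym (p∩q⊆p ⁅ x ⁆ S)
  λ y∈ → x∈p∩q⁺ (y∈ , ⁅x⁆⊆p x∈S y∈))) (∣⁅x⁆∣≡1 x)

∣⁅x⁆∩p∣≡0 : {x : Fin v} {S : Subset v} → ¬ x ∈ S → ∣ ⁅ x ⁆ ∩ S ∣ ≡ 0
∣⁅x⁆∩p∣≡0 {x = x} {S} x∉S = empty⇒∣p∣≡0 λ (y , y∈) →
  let y∈⁅x⁆ , y∈S = x∈p∩q⁻ ⁅ x ⁆ S y∈ in x∉S (subst (_∈ S) (x∈⁅y⁆⇒x≡y x y∈⁅x⁆) y∈S)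

∣⁅x⁆∣≡∣⁅y⁆∣ : (x y : Fin v) → ∣ ⁅ x ⁆ ∣ ≡ ∣ ⁅ y ⁆ ∣
∣⁅x⁆∣≡∣⁅y⁆∣ x y = trans (∣⁅x⁆∣≡1 x) (sym (∣⁅x⁆∣≡1 y))

move-pair : {x y x′ y′ : Fin v} → x ≢ y → x′ ≢ y′ →
  ∃[ π ] to π x ≡ x′ × to π y ≡ y′
move-pair {x = x} {y} {x′} {y′} x≢y x′≢y′ =
  let π , c , d = carry-pair ⁅ x ⁆ ⁅ y ⁆ ⁅ x′ ⁆ ⁅ y′ ⁆ (∣⁅x⁆∣≡∣⁅y⁆∣ x x′) (∣⁅x⁆∣≡∣⁅y⁆∣ y y′)
                    (trans (∣⁅x⁆∩p∣≡0 (x≢y⇒x∉⁅y⁆ x≢y)) (sym (∣⁅x⁆∩p∣≡0 (x≢y⇒x∉⁅y⁆ x′≢y′))))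
  in π , carries-⁅⁆ π x x′ c , carries-⁅⁆ π y y′ d

Common : (v k : ℕ) → Fin v → Fin v → Set
Common v k x y = Σ (KSubset v k) λ b → x ∈ proj₁ b × y ∈ proj₁ b

×-irrelevant : (x y : Fin v) → Irrelevant {A = KSubset v k} (λ b → x ∈ proj₁ b × y ∈ proj₁ b)
×-irrelevant _ _ (a , b) (c , d) = cong₂ _,_ ([]=-irrelevant a c) ([]=-irrelevant b d)

move-common : {x y x′ y′ : Fin v} (α : Automorphism (completeDesign v k)) →
  to (onPoints α) x ≡ x′ → to (onPoints α) y ≡ y′ → Common v k x y ↔ Common v k x′ y′
move-common {x = x} {y} α refl refl =
  Σ-↔-irrelevant (onBlocks α)
    (λ {b} → ×-irrelevant _ _ {b}) (λ {b} → ×-irrelevant _ _ {b}) λ b → mk⇔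
    (λ (p , q) → ⇒ (carries-onBlocks α b x) p , ⇒ (carries-onBlocks α b y) q)
    (λ (p , q) → ⇐ (carries-onBlocks α b x) p , ⇐ (carries-onBlocks α b y) q)

common₀₁ : Common (suc (suc v)) (suc (suc k)) zero (suc zero) ↔ KSubset v k
common₀₁ = mk↔ₛ′
  (λ { ((inside ∷ inside ∷ S , e) , here , there here) → S , suc-injective (suc-injective e) })
  (λ (S , e) → (inside ∷ inside ∷ S , cong suc (cong suc e)) , here , there here)
  (λ _ → KSubset-≡ refl)
  (λ { (b@(inside ∷ inside ∷ S , e) , here , there here) →
         Σ-≡,≡→≡ (KSubset-≡ refl , ×-irrelevant _ _ {b} _ _) })

complete-is2Design : 1 < k → k ≤ v → ∃[ lam ] Is2-⟨ v , k , lam ⟩-Design (completeDesign v k)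
complete-is2Design {suc (suc k)} {suc (suc v)} 1<k k≤v = proj₁ (KSubset-finite v k) , record
  { points       = ↔-id _
  ; blockSize    = λ (S , e) → cast-id e ↔-∘ elements S
  ; commonBlocks = λ p≢q → let π , πp , πq = move-pair p≢q (λ ()) in
      proj₂ (KSubset-finite v k) ↔-∘ (common₀₁ ↔-∘ move-common (liftAut π) πp πq)
  }
complete-is2Design {suc (suc k)} {suc zero} 1<k (s≤s ())
complete-is2Design {suc zero}    (s≤s ())

complete-parameters : ∀ {v′ k′ lam} → k ≤ v →
  Is2-⟨ v′ , k′ , lam ⟩-Design (completeDesign v k) → v ≡ v′ × k ≡ k′
complete-parameters k≤v d =
  let S , e = subsetOfSize k≤v in
  ↔⇒≡ (Is2-⟨_,_,_⟩-Design.points d) ,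
  trans (sym e) (↔⇒≡ (Is2-⟨_,_,_⟩-Design.blockSize d (S , e) ↔-∘ ↔-sym (elements S)))

-- Pairwise transitivity under Sym(v)

module _ {v k : ℕ} where
  private
    C = completeDesign v k
    G = whole (Aut C)

  Sym-transitiveOnPoints : TransitiveOnPairs {D = C} G onPoints onPoints _≢_
  Sym-transitiveOnPoints x≢y x′≢y′ = let π , e , f = move-pair x≢y x′≢y′ in liftAut π , tt , e , f

  move-point-block : (x x′ : Fin v) (b b′ : KSubset v k) →
    ∣ ⁅ x ⁆ ∩ proj₁ b ∣ ≡ ∣ ⁅ x′ ⁆ ∩ proj₁ b′ ∣ →
    ∃[ α ] Subgroup.Member G α × to (onPoints α) x ≡ x′ × to (onBlocks α) b ≡ b′
  move-point-block x x′ b@(S , e) b′@(S′ , e′) h =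
    let π , c , d = carry-pair ⁅ x ⁆ S ⁅ x′ ⁆ S′ (∣⁅x⁆∣≡∣⁅y⁆∣ x x′) (trans e (sym e′)) h
    in liftAut π , tt , carries-⁅⁆ π x x′ c , onBlocks-≡ (liftAut π) b b′ d

  move-blocks : (b c b′ c′ : KSubset v k) →
    ∣ proj₁ b ∩ proj₁ c ∣ ≡ ∣ proj₁ b′ ∩ proj₁ c′ ∣ →
    ∃[ α ] Subgroup.Member G α × to (onBlocks α) b ≡ b′ × to (onBlocks α) c ≡ c′
  move-blocks b@(S , e) c@(T , f) b′@(S′ , e′) c′@(T′ , f′) h =
    let π , p , q = carry-pair S T S′ T′ (trans e (sym e′)) (trans f (sym f′)) h
    in liftAut π , tt , onBlocks-≡ (liftAut π) b b′ p , onBlocks-≡ (liftAut π) c c′ q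

  disjoint⇒∣∩∣≡0 : (b c : KSubset v k) → ¬ Intersecting {D = C} b c →
    ∣ proj₁ b ∩ proj₁ c ∣ ≡ 0
  disjoint⇒∣∩∣≡0 (S , _) (T , _) h = empty⇒∣p∣≡0 λ (x , x∈) → h (x , x∈p∩q⁻ S T x∈)

  Sym-pairwiseTransitive :
    TransitiveOnPairs {D = C} G onBlocks onBlocks (λ b c → b ≢ c × Intersecting {D = C} b c) →
    PairwiseTransitive {D = C} G
  Sym-pairwiseTransitive t = record
    { points          = Sym-transitiveOnPoints
    ; flags           = λ {x} {x′} {b} {b′} p p′ → move-point-block x x′ b b′
        (trans (∣⁅x⁆∩p∣≡1 p) (sym (∣⁅x⁆∩p∣≡1 p′)))
    ; antiflags       = λ {x} {x′} {b} {b′} p p′ → move-point-block x x′ b b′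
        (trans (∣⁅x⁆∩p∣≡0 p) (sym (∣⁅x⁆∩p∣≡0 p′)))
    ; intersecting    = t
    ; nonIntersecting = λ {b} {b′} {c} {c′} p p′ → move-blocks b c b′ c′
        (trans (disjoint⇒∣∩∣≡0 b c p) (sym (disjoint⇒∣∩∣≡0 b′ c′ p′)))
    }

Sym-pairwiseTransitive-2 : PairwiseTransitive {D = completeDesign v 2} (whole (Aut (completeDesign v 2)))
Sym-pairwiseTransitive-2 {v} = Sym-pairwiseTransitive λ {b} {b′} {c} {c′} p p′ →
  move-blocks b c b′ c′ (trans (meet b c p) (sym (meet b′ c′ p′)))
  where
  meet : (b c : KSubset v 2) → b ≢ c × Intersecting {D = completeDesign v 2} b c →
    ∣ proj₁ b ∩ proj₁ c ∣ ≡ 1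
  meet (S , e) (T , f) (b≢c , x , x∈S , x∈T)
    with ∣ S ∩ T ∣ in g | nonempty⇒0<∣p∣ (x , x∈p∩q⁺ (x∈S , x∈T))
  ... | 1           | _ = refl
  ... | suc (suc m) | _ = contradiction (KSubset-≡ (⊆-antisym
    (∣p∣≤∣p∩q∣⇒p⊆q S T (2≤ e g)) (∣p∣≤∣p∩q∣⇒p⊆q T S (2≤ f (trans (cong ∣_∣ (∩-comm T S)) g))))) b≢c
    where
    2≤ : ∀ {i j} → i ≡ 2 → j ≡ suc (suc m) → i ≤ j
    2≤ refl refl = s≤s (s≤s z≤n)

Sym-pairwiseTransitive-v : PairwiseTransitive {D = completeDesign v v} (whole (Aut (completeDesign v v)))
Sym-pairwiseTransitive-v = Sym-pairwiseTransitive λ {(_ , e)} {_} {(_ , f)} (b≢c , _) _ →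
  contradiction (KSubset-≡ (trans (∣p∣≡n⇒p≡⊤ e) (sym (∣p∣≡n⇒p≡⊤ f)))) b≢c

-- 11100R meets 11010R and 10011R in different numbers of points.
complete-not-pairwiseTransitive : 2 < k → suc k < v →
  (G : Subgroup (Aut (completeDesign v k)) s) → ¬ PairwiseTransitive {D = completeDesign v k} G
complete-not-pairwiseTransitive
  (s≤s (s≤s (s≤s (z≤n {j})))) (s≤s (s≤s (s≤s (s≤s (s≤s {n = w} j≤w))))) G t =
  contradiction same 2+j≢1+j
  where
  rest = subsetOfSize j≤w
  R    = proj₁ rest
  ∣R∣≡ = proj₂ rest

  b c d : KSubset (5 + w) (3 + j)
  b = inside ∷ inside  ∷ inside  ∷ outside ∷ outside ∷ R , cong (3 +_) ∣R∣≡
  c = inside ∷ inside  ∷ outside ∷ inside  ∷ outside ∷ R , cong (3 +_) ∣R∣≡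
  d = inside ∷ outside ∷ outside ∷ inside  ∷ inside  ∷ R , cong (3 +_) ∣R∣≡

  moved = PairwiseTransitive.intersecting t {b} {b} {c} {d}
    ((λ ()) , zero , here , here) ((λ ()) , zero , here , here)

  α  = proj₁ moved
  αb = proj₁ (proj₂ (proj₂ moved))
  αc = proj₂ (proj₂ (proj₂ moved))

  same : 2 + ∣ R ∩ R ∣ ≡ 1 + ∣ R ∩ R ∣
  same = carries-size (onPoints α) {proj₁ b ∩ proj₁ c} {proj₁ b ∩ proj₁ d}
    (carries-∩ (onPoints α)
      (subst (Carries (onPoints α) (proj₁ b) ∘ proj₁) αb (carries-onBlocks α b))
      (subst (Carries (onPoints α) (proj₁ c) ∘ proj₁) αc (carries-onBlocks α c)))

  2+j≢1+j : 2 + ∣ R ∩ R ∣ ≢ 1 + ∣ R ∩ R ∣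
  2+j≢1+j e = <⇒≢ (n<1+n (1 + ∣ R ∩ R ∣)) (sym e)

-- Blocks of size v − 1

copoint : Fin (suc v) → KSubset (suc v) v
copoint {v} x = ∁ ⁅ x ⁆ , trans (∣∁p∣≡n∸∣p∣ ⁅ x ⁆) (cong (suc v ∸_) (∣⁅x⁆∣≡1 x))

∈copoint : {x y : Fin (suc v)} → x ∈ proj₁ (copoint y) ⇔ x ≢ y
∈copoint = mk⇔ (x∉⁅y⁆⇒x≢y ∘ x∈∁p⇒x∉p) (x∉p⇒x∈∁p ∘ x≢y⇒x∉⁅y⁆)

copoint-surjective : (b : KSubset (suc v) v) → ∃[ x ] copoint x ≡ b
copoint-surjective {v} (S , e) =
  let x , ∁S≡ = ∣p∣≡1⇒singleton (∁ S) (trans (∣∁p∣≡n∸∣p∣ S)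
                  (trans (cong (suc v ∸_) e) (m+n∸n≡m 1 v)))
  in x , KSubset-≡ (trans (cong ∁ (sym ∁S≡)) (∁-involutive S))

copoint-injective : {x y : Fin (suc v)} → copoint x ≡ copoint y → x ≡ y
copoint-injective {x = x} {y} e = ⁅x⁆-injective (trans (sym (∁-involutive ⁅ x ⁆))
  (trans (cong (∁ ∘ proj₁) e) (∁-involutive ⁅ y ⁆)))

copoints : Fin (suc v) ↔ KSubset (suc v) v
copoints = mk↔ₛ′ copoint (proj₁ ∘ copoint-surjective) (proj₂ ∘ copoint-surjective)
  (λ x → copoint-injective (proj₂ (copoint-surjective (copoint x))))

avoid-one : (x : Fin (suc (suc v))) → ∃[ z ] z ≢ x
avoid-one x = punchIn x zero , punchInᵢ≢i x zero

avoid-two : (x y : Fin (suc (suc (suc v)))) → ∃[ z ] z ≢ x × z ≢ y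
avoid-two x y with x ≟ y
... | yes refl = let z , z≢x = avoid-one x in z , z≢x , z≢x
... | no x≢y   =
  let z , z≢ = avoid-one (punchOut x≢y) in
  punchIn x z , punchInᵢ≢i x z ,
  λ e → z≢ (punchIn-injective x _ _ (trans e (sym (punchIn-punchOut x≢y))))

points⇒twoTransitive : {D : Design} (G : Subgroup (Aut D) s) →
  TransitiveOnPairs {D = D} G onPoints onPoints _≢_ → TwoTransitive (inducedOnPoints {D = D} G)
points⇒twoTransitive G t x≢y x′≢y′ =
  let α , g , e , f = t x≢y x′≢y′ in onPoints α , (α , g , λ _ → refl) , e , f

twoTransitive⇒points : {D : Design} (G : Subgroup (Aut D) s) →
  TwoTransitive (inducedOnPoints {D = D} G) → TransitiveOnPairs {D = D} G onPoints onPoints _≢_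
twoTransitive⇒points G t {x} {y = y} x≢y x′≢y′ =
  let π , (α , g , h) , e , f = t x≢y x′≢y′ in α , g , trans (h x) e , trans (h y) f

twoTransitive⇒pairwiseTransitive : ∀ {n} (G : Subgroup (Aut (completeDesign (suc n) n)) s) →
  1 < n → TwoTransitive (inducedOnPoints {D = completeDesign (suc n) n} G) →
  PairwiseTransitive {D = completeDesign (suc n) n} G
twoTransitive⇒pairwiseTransitive {n = suc (suc m)} G (s≤s (s≤s z≤n)) t = record
  { points          = pts
  ; flags           = λ {_} {_} {b} {b′} → flags (copoint-surjective b) (copoint-surjective b′)
  ; antiflags       = λ {_} {_} {b} {b′} → antiflags (copoint-surjective b) (copoint-surjective b′)
  ; intersecting    = λ {b} {b′} {c} {c′} p p′ → distinct
      (copoint-surjective b) (copoint-surjective b′) (copoint-surjective c) (copoint-surjective c′)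
      (proj₁ p) (proj₁ p′)
  ; nonIntersecting = λ {b} {_} {c} p _ →
      contradiction (meet (copoint-surjective b) (copoint-surjective c)) p
  }
  where
  n = suc (suc m)
  D = completeDesign (suc n) n

  pts = twoTransitive⇒points {D = D} G t

  copoint-moved : (α : Automorphism D) {x y : Fin (suc n)} →
    to (onPoints α) x ≡ y → to (onBlocks α) (copoint x) ≡ copoint y
  copoint-moved α {x} refl = onBlocks-≡ α (copoint x) (copoint (to (onPoints α) x)) λ z → mk⇔
    (λ z∈ → ⇐ ∈copoint λ e → ⇒ ∈copoint z∈ (injective e))
    (λ z∈ → ⇐ ∈copoint λ e → ⇒ ∈copoint z∈ (cong (to (onPoints α)) e))
    where
    injective : ∀ {z} → to (onPoints α) z ≡ to (onPoints α) x → z ≡ x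
    injective e = trans (sym (strictlyInverseʳ (onPoints α) _))
      (trans (cong (from (onPoints α)) e) (strictlyInverseʳ (onPoints α) x))

  flags : ∀ {x x′ b b′} → (∃[ y ] copoint y ≡ b) → (∃[ y ] copoint y ≡ b′) →
    x ∈ proj₁ b → x′ ∈ proj₁ b′ →
    ∃[ α ] Subgroup.Member G α × to (onPoints α) x ≡ x′ × to (onBlocks α) b ≡ b′
  flags (y , refl) (y′ , refl) x∈ x′∈ =
    let α , g , e , f = pts (⇒ ∈copoint x∈) (⇒ ∈copoint x′∈) in α , g , e , copoint-moved α f

  antiflags : ∀ {x x′ b b′} → (∃[ y ] copoint y ≡ b) → (∃[ y ] copoint y ≡ b′) →
    ¬ x ∈ proj₁ b → ¬ x′ ∈ proj₁ b′ →
    ∃[ α ] Subgroup.Member G α × to (onPoints α) x ≡ x′ × to (onBlocks α) b ≡ b′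
  antiflags {x} {x′} (y , refl) (y′ , refl) x∉ x′∉ with x ≟ y | x′ ≟ y′
  ... | no x≢y   | _          = contradiction (⇐ ∈copoint x≢y) x∉
  ... | yes _    | no x′≢y′   = contradiction (⇐ ∈copoint x′≢y′) x′∉
  ... | yes refl | yes refl   =
    let α , g , _ , f = pts (proj₂ (avoid-one x)) (proj₂ (avoid-one x′))
    in α , g , f , copoint-moved α f

  distinct : ∀ {b b′ c c′} → (∃[ y ] copoint y ≡ b) → (∃[ y ] copoint y ≡ b′) →
    (∃[ y ] copoint y ≡ c) → (∃[ y ] copoint y ≡ c′) → b ≢ c → b′ ≢ c′ →
    ∃[ α ] Subgroup.Member G α × to (onBlocks α) b ≡ b′ × to (onBlocks α) c ≡ c′
  distinct (_ , refl) (_ , refl) (_ , refl) (_ , refl) b≢c b′≢c′ =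
    let α , g , e , f = pts (b≢c ∘ cong copoint) (b′≢c′ ∘ cong copoint)
    in α , g , copoint-moved α e , copoint-moved α f

  meet : ∀ {b c} → (∃[ y ] copoint y ≡ b) → (∃[ y ] copoint y ≡ c) → Intersecting {D = D} b c
  meet (x , refl) (y , refl) =
    let z , z≢x , z≢y = avoid-two x y in z , ⇐ ∈copoint z≢x , ⇐ ∈copoint z≢y

copoint-isSymmetric : ∀ v → 1 < v ∸ 1 → IsSymmetric2Design (completeDesign v (v ∸ 1))
copoint-isSymmetric (suc n) 1<n =
  let lam , d = complete-is2Design 1<n (m∸n≤m (suc n) 1)
  in suc n , n , lam , d , ↔-sym copoints

pairwiseTransitive⇒k : 1 < k → k ≤ v → (G : Subgroup (Aut (completeDesign v k)) s) →
  PairwiseTransitive {D = completeDesign v k} G → k ≡ 2 ⊎ k ≡ v ∸ 1 ⊎ k ≡ v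
pairwiseTransitive⇒k {zero}  {zero}  () _ _ _
pairwiseTransitive⇒k {suc _} {zero}  _ () _ _
pairwiseTransitive⇒k {k}     {suc n} 1<k k≤v G t with k ≟ℕ 2 | k ≟ℕ n | k ≟ℕ suc n
... | yes k≡2 | _       | _       = inj₁ k≡2
... | no _    | yes k≡n | _       = inj₂ (inj₁ k≡n)
... | no _    | no _    | yes k≡v = inj₂ (inj₂ k≡v)
... | no k≢2  | no k≢n  | no k≢v  = contradiction t (complete-not-pairwiseTransitive
  (≤∧≢⇒< 1<k (k≢2 ∘ sym)) (s≤s (≤∧≢⇒< (s≤s⁻¹ (≤∧≢⇒< k≤v k≢v)) k≢n)) G)

k⇒Sym-pairwiseTransitive : 1 < k → k ≤ v → k ≡ 2 ⊎ k ≡ v ∸ 1 ⊎ k ≡ v →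
  PairwiseTransitive {D = completeDesign v k} (whole (Aut (completeDesign v k)))
k⇒Sym-pairwiseTransitive 1<k k≤v (inj₁ refl)        = Sym-pairwiseTransitive-2
k⇒Sym-pairwiseTransitive 1<k k≤v (inj₂ (inj₂ refl)) = Sym-pairwiseTransitive-v
k⇒Sym-pairwiseTransitive {v = suc n} 1<k k≤v (inj₂ (inj₁ refl)) =
  twoTransitive⇒pairwiseTransitive (whole _) 1<k
    (points⇒twoTransitive {D = completeDesign (suc n) n} (whole _) Sym-transitiveOnPoints)

nonTrivial⇒2<k<v : k ≤ v → IsNonTrivial2Design (completeDesign v k) → 2 < k × k < v
nonTrivial⇒2<k<v k≤v (_ , _ , _ , d , 2<k′ , k′<v′) with complete-parameters k≤v d
... | refl , refl = 2<k′ , k′<v′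

lemma2p6 : ∀ {s : Level} (v k : ℕ) → 1 < k → k ≤ v →
    let C = completeDesign v k in
    IsGroupIsomorphism (Group.rawGroup (Aut C)) (Group.rawGroup (Sym (Fin v))) onPoints
    × ((Is2Design C × PairwiseTransitive {D = C} (whole (Aut C)))
    ⇔ (k ≡ 2 ⊎ k ≡ v ∸ 1 ⊎ k ≡ v))
    × ((G : Subgroup (Aut C) s) →
    (IsNonTrivial2Design C × PairwiseTransitive {D = C} G)
    ⇔ ((k ≡ v ∸ 1 × k ≥ 3) × TwoTransitive (inducedOnPoints {D = C} G)))
    × (1 < v ∸ 1 → IsSymmetric2Design (completeDesign v (v ∸ 1)))
lemma2p6 {s} v k 1<k k≤v =
  onPoints-isGroupIsomorphism v k ,
  mk⇔ (λ (_ , t) → pairwiseTransitive⇒k 1<k k≤v (whole _) t)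
      (λ h → (v , k , complete-is2Design 1<k k≤v) , k⇒Sym-pairwiseTransitive 1<k k≤v h) ,
  (λ G → mk⇔ (nonTrivial⇒ G) (⇒nonTrivial G)) ,
  copoint-isSymmetric v
  where
  C = completeDesign v k

  nonTrivial⇒ : (G : Subgroup (Aut C) s) → IsNonTrivial2Design C × PairwiseTransitive {D = C} G →
    (k ≡ v ∸ 1 × k ≥ 3) × TwoTransitive (inducedOnPoints {D = C} G)
  nonTrivial⇒ G (nt , t) with nonTrivial⇒2<k<v k≤v nt | pairwiseTransitive⇒k 1<k k≤v G t
  ... | 2<k , k<v | inj₁ k≡2          = contradiction (sym k≡2) (<⇒≢ 2<k)
  ... | 2<k , k<v | inj₂ (inj₂ k≡v)   = contradiction k≡v (<⇒≢ k<v)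
  ... | 2<k , k<v | inj₂ (inj₁ k≡v-1) =
    (k≡v-1 , 2<k) , points⇒twoTransitive {D = C} G (PairwiseTransitive.points t)

  ⇒nonTrivial : (G : Subgroup (Aut C) s) →
    (k ≡ v ∸ 1 × k ≥ 3) × TwoTransitive (inducedOnPoints {D = C} G) →
    IsNonTrivial2Design C × PairwiseTransitive {D = C} G
  ⇒nonTrivial = byPointCount v 1<k k≤v
    where
    byPointCount : ∀ v {k} → 1 < k → k ≤ v → (G : Subgroup (Aut (completeDesign v k)) s) →
      (k ≡ v ∸ 1 × k ≥ 3) × TwoTransitive (inducedOnPoints {D = completeDesign v k} G) →
      IsNonTrivial2Design (completeDesign v k) × PairwiseTransitive {D = completeDesign v k} G
    byPointCount zero    1<k k≤v G ((refl , ()) , _)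
    byPointCount (suc n) 1<k k≤v G ((refl , 3≤n) , t) =
      (let lam , d = complete-is2Design 1<k k≤v in suc n , n , lam , d , 3≤n , n<1+n n) ,
      twoTransitive⇒pairwiseTransitive G 1<k t
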